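{- In the sequent system $\mathbf{CFL}_{ew}$, for all formulas $a_1,\dots,a_n$ and $b$ and every term $G$ built from the symbols "$,$", $\circ_2,\bullet_2,\circ_\alpha,\epsilon$ such that there exists a deduction of $G(a_1,\dots,a_n)\vdash b$ using the cut rule (i.e. in $\mathbf{CFL}_{ew}$ augmented with the cut rule), there exists a deduction of $G(a_1,\dots,a_n)\vdash b$ not using the cut rule.
   Context: **Syntax.** Formulas are built from propositional variables by the constant $\underline 0$, the binary symbols $\dot+,\dot-,\wedge,\vee$ and the unary symbols $2,\frac{\cdot}{2},j_*,j,\alpha,\blacksquare_\alpha$; $\underline 1$ abbreviates $2j_*(\underline 0)$. Structures are built from formulas by a binary symbol "$,$", unary symbols $\circ_2,\bullet_2,\circ_\alpha$ and a constant $\epsilon$. A context $\Gamma[\ ]$ is a structure with one hole. A sequent is $\gamma\vdash b$, with $\gamma$ a structure and $b$ a formula. For a dyadic $d=k/2^n\in(0,1)$ with $k$ odd, $\epsilon_d$ is the structure consisting of $k$ copies of $\circ_\alpha^{n-1}\bullet_2\epsilon$ joined by "$,$"; $\epsilon_0=\epsilon$; $\epsilon_1=\circ_2\bullet_2\epsilon$. **Rules of $\mathbf{CFL}_{ew}$** (premises / conclusion; "$\Leftrightarrow$" means both directions; $a,b,c,A$ formulas, $\gamma,\delta,\pi$ structures). Logical rules: $/\ a\vdash a$; $\Gamma[a,b]\vdash c\ /\ \Gamma[a\dot+b]\vdash c$; $\gamma\vdash a,\ \delta\vdash b\ /\ \gamma,\delta\vdash a\dot+b$; $\Gamma[b]\vdash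 c,\ \gamma\vdash a\ /\ \Gamma[(b\dot-a),\gamma]\vdash c$, and the same with conclusion $\Gamma[\gamma,(b\dot-a)]\vdash c$; $\gamma,a\vdash b\ /\ \gamma\vdash b\dot-a$, and the same with premise $a,\gamma\vdash b$; $\Gamma[\epsilon]\vdash a\ /\ \Gamma[\underline 0]\vdash a$; $/\ \epsilon\vdash\underline 0$; $\Gamma[a]\vdash c,\ \Gamma[b]\vdash c\ /\ \Gamma[a\wedge b]\vdash c$; $\gamma\vdash a\ /\ \gamma\vdash a\wedge b$; $\gamma\vdash b\ /\ \gamma\vdash a\wedge b$; $\Gamma[a]\vdash c\ /\ \Gamma[a\vee b]\vdash c$; $\Gamma[b]\vdash c\ /\ \Gamma[a\vee b]\vdash c$; $\gamma\vdash a,\ \gamma\vdash b\ /\ \gamma\vdash a\vee b$. Modal rules, for $(\circ,P,N)$ each of $(\circ_2,2,\frac{\cdot}{2})$, $(\bullet_2,j_*,j)$, $(\circ_\alpha,\alpha,\blacksquare_\alpha)$: $\Gamma[\circ a]\vdash b\ /\ \Gamma[Pa]\vdash b$; $\gamma\vdash a\ /\ \circ\gamma\vdash Pa$; $\Gamma[a]\vdash b\ /\ \Gamma[\circ Na]\vdash b$; $\circ\gamma\vdash a\ /\ \gamma\vdash Na$. Structural rules: - $\Gamma[\gamma,\delta]\vdash A\ /\ \Gamma[\delta,\gamma]\vdash A$; $\Gamma[\gamma,(\delta,\pi)]\vdash A\ /\ \Gamma[(\gamma,\delta),\pi]\vdash A$; $\Gamma[\epsilon,\gamma]\vdash A\Leftrightarrow\Gamma[\gamma]\vdash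 A$; - $\Gamma[\gamma]\vdash A\ /\ \Gamma[\circ_2\gamma]\vdash A$; $\Gamma[\gamma]\vdash A\ /\ \Gamma[\bullet_2\gamma]\vdash A$; $\Gamma[\epsilon]\vdash A\ /\ \Gamma[\gamma]\vdash A$; - $\Gamma[\circ_2\gamma]\vdash A,\ \Gamma[\circ_2\delta]\vdash A\ /\ \Gamma[\gamma,\delta]\vdash A$; $\Gamma[\circ_2(\gamma,\delta)]\vdash A\Leftrightarrow\Gamma[\circ_2\gamma,\circ_2\delta]\vdash A$; $/\ \epsilon_1\vdash A$; - $\Gamma[\bullet_2(\circ_2\gamma,\delta)]\vdash A\Leftrightarrow\Gamma[\gamma,\bullet_2\delta]\vdash A$; - $\Gamma[\gamma]\vdash A\ /\ \Gamma[\circ_\alpha\circ_2\gamma]\vdash A$; $\Gamma[\gamma]\vdash A\ /\ \Gamma[\circ_\alpha\bullet_2\gamma]\vdash A$; $\Gamma[\circ_\alpha\circ_2\gamma]\vdash A,\ \Gamma[\circ_\alpha\bullet_2\gamma]\vdash A\ /\ \Gamma[\gamma]\vdash A$; - $\Gamma[\gamma]\vdash A\ /\ \Gamma[\circ_2\circ_\alpha\gamma]\vdash A$; $\Gamma[\gamma]\vdash A\ /\ \Gamma[\bullet_2\circ_\alpha\gamma]\vdash A$; $\Gamma[\circ_2\circ_\alpha\gamma]\vdash A,\ \Gamma[\bullet_2\circ_\alpha\gamma]\vdash A\ /\ \Gamma[\gamma]\vdash A$; - for dyadic $d\in[0,1]$ and $n\in\mathbb N$: $\Gamma[\gamma]\vdash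 A\ /\ \Gamma[\epsilon_d,\circ_\alpha^n(\gamma,\epsilon_{1-d})]\vdash A$; - for $n\ge1$: $\Gamma[\epsilon_{1/2^n},\epsilon_{1/2^n}]\vdash A\ /\ \Gamma[\epsilon_{1/2^{n-1}}]\vdash A$; - (infinitary) $\Gamma[\epsilon_{1/2^n}]\vdash A$ for all $n\in\mathbb N\ /\ \Gamma[\epsilon]\vdash A$; - for $n\in\mathbb N$: $\Gamma[\epsilon_{1-k/2^{n+1}},\circ_\alpha^{n+1}(\gamma,\epsilon_{k/2^{n+1}})]\vdash A$ for $k=1,\dots,2^{n+1}-2\ /\ \Gamma[\gamma,\epsilon_{1/2^n}]\vdash A$. **Cut rule** (not part of $\mathbf{CFL}_{ew}$): $\gamma\vdash a,\ \Gamma[a]\vdash b\ /\ \Gamma[\gamma]\vdash b$. -}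

module Defs where

open import Data.Nat using (ℕ; zero; suc; _*_; _∸_; _^_; _≤_)
open import Data.Nat.Divisibility using (_∣_; _∣?_; divides; m∣m*n)
open import Data.Nat.GeneralisedArithmetic using (fold)
open import Data.Nat.Properties using (*-cancelʳ-≡; *-comm)
open import Relation.Nullary using (¬_; yes; no; contradiction)
open import Relation.Binary.PropositionalEquality using (_≡_; refl; sym; trans; cong)

-- Each modality is an adjoint pair of unary connectives (P m, N m) together
-- with the structural symbol ⟪ m ⟫:
--   𝟐 : (∘₂ , 2 , ·/2)     𝐣 : (∙₂ , j⁎ , j)     𝛂 : (∘α , α , ■α)
data Modality : Set where
  𝟐 𝐣 𝛂 : Modality

infixr 8 _⊕_
infixl 8 _⊖_
infixr 7 _∧_
infixr 6 _∨_

-- ⊕ and ⊖ are the dotted sum and dotted difference (truncated subtraction).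
data Formula : Set where
  var : ℕ → Formula
  𝟎   : Formula
  _⊕_ _⊖_ _∧_ _∨_ : Formula → Formula → Formula
  P N : Modality → Formula → Formula

pattern twice a = P 𝟐 a
pattern half a = N 𝟐 a
pattern j⁎ a = P 𝐣 a
pattern j a = N 𝐣 a
pattern α a = P 𝛂 a
pattern ■α a = N 𝛂 a

𝟏 : Formula
𝟏 = twice (j⁎ 𝟎)

infixr 5 _⨾_
infixr 9 ⟪_⟫_ ∘₂_ ∙₂_ ∘α_

-- Terms over a set X of leaves; _⨾_ is the structural comma.
data Term (X : Set) : Set where
  leaf  : X → Term X
  ε     : Term X
  _⨾_   : Term X → Term X → Term X
  ⟪_⟫_ : Modality → Term X → Term X

pattern ∘₂_ γ = ⟪ 𝟐 ⟫ γ
pattern ∙₂_ γ = ⟪ 𝐣 ⟫ γ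
pattern ∘α_ γ = ⟪ 𝛂 ⟫ γ

Structure : Set
Structure = Term Formula

infix 10 _⟨_⟩

_⟨_⟩ : {X Y : Set} → Term X → (X → Term Y) → Term Y
leaf x    ⟨ σ ⟩ = σ x
ε         ⟨ σ ⟩ = ε
(G ⨾ H)   ⟨ σ ⟩ = G ⟨ σ ⟩ ⨾ H ⟨ σ ⟩
(⟪ m ⟫ G) ⟨ σ ⟩ = ⟪ m ⟫ (G ⟨ σ ⟩)

data Context : Set where
  hole   : Context
  _⨾ˡ_   : Context → Structure → Context
  _⨾ʳ_   : Structure → Context → Context
  ⟪_⟫ᶜ_ : Modality → Context → Context

infix 10 _[_]

_[_] : Context → Structure → Structure
hole       [ γ ] = γ
(Γ ⨾ˡ δ)   [ γ ] = Γ [ γ ] ⨾ δ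
(δ ⨾ʳ Γ)   [ γ ] = δ ⨾ Γ [ γ ]
(⟪ m ⟫ᶜ Γ) [ γ ] = ⟪ m ⟫ (Γ [ γ ])

∘α^ : ℕ → Structure → Structure
∘α^ n γ = fold γ ∘α_ n

ε₁ : Structure
ε₁ = ∘₂ ∙₂ ε

-- Only used with k ≥ 1.
copies : ℕ → Structure → Structure
copies zero          γ = ε
copies (suc zero)    γ = γ
copies (suc (suc k)) γ = γ ⨾ copies (suc k) γ

-- ε[ k /2^ n ] is ε_d for the dyadic d = k / 2ⁿ ∈ [0,1], i.e. k ≤ 2ⁿ. The
-- fraction need not be in lowest terms; it is reduced first, so that the result
-- depends on d only. (Values at k > 2ⁿ are irrelevant.)
ε[_/2^_] : ℕ → ℕ → Structure
ε[ k /2^ suc n ] with 2 ∣? k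
... | yes (divides q _) = ε[ q /2^ n ]
... | no  _             = copies k (∘α^ n (∙₂ ε))
ε[ zero  /2^ zero ] = ε
ε[ suc _ /2^ zero ] = ε₁

ε-odd : ∀ k n → ¬ (2 ∣ k) → ε[ k /2^ suc n ] ≡ copies k (∘α^ n (∙₂ ε))
ε-odd k n odd with 2 ∣? k
... | yes even = contradiction even odd
... | no  _    = refl

ε-reduce : ∀ k n → ε[ 2 * k /2^ suc n ] ≡ ε[ k /2^ n ]
ε-reduce k n with 2 ∣? (2 * k)
... | yes (divides q eq) = cong ε[_/2^ n ] (*-cancelʳ-≡ q k 2 (trans (sym eq) (*-comm 2 k)))
... | no  odd            = contradiction (m∣m*n k) odd

ε-zero : ∀ n → ε[ 0 /2^ n ] ≡ ε
ε-zero zero    = refl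
ε-zero (suc n) = trans (ε-reduce 0 n) (ε-zero n)

ε-one : ∀ n → ε[ 2 ^ n /2^ n ] ≡ ε₁
ε-one zero    = refl
ε-one (suc n) = trans (ε-reduce (2 ^ n) n) (ε-one n)

data Mode : Set where
  cutFree withCut : Mode

infix 3 _⊢⟨_⟩_

-- γ ⊢⟨ cutFree ⟩ b is derivability in CFL_ew, and γ ⊢⟨ withCut ⟩ b is
-- derivability in CFL_ew augmented with the cut rule.
data _⊢⟨_⟩_ : Structure → Mode → Formula → Set where

  cut : ∀ {γ a b} Γ →
        γ ⊢⟨ withCut ⟩ a → Γ [ leaf a ] ⊢⟨ withCut ⟩ b → Γ [ γ ] ⊢⟨ withCut ⟩ b

  ax  : ∀ {μ a} → leaf a ⊢⟨ μ ⟩ a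

  ⊕L  : ∀ {μ a b c} Γ → Γ [ leaf a ⨾ leaf b ] ⊢⟨ μ ⟩ c → Γ [ leaf (a ⊕ b) ] ⊢⟨ μ ⟩ c
  ⊕R  : ∀ {μ γ δ a b} → γ ⊢⟨ μ ⟩ a → δ ⊢⟨ μ ⟩ b → γ ⨾ δ ⊢⟨ μ ⟩ a ⊕ b

  ⊖L₁ : ∀ {μ γ a b c} Γ →
        Γ [ leaf b ] ⊢⟨ μ ⟩ c → γ ⊢⟨ μ ⟩ a → Γ [ leaf (b ⊖ a) ⨾ γ ] ⊢⟨ μ ⟩ c
  ⊖L₂ : ∀ {μ γ a b c} Γ →
        Γ [ leaf b ] ⊢⟨ μ ⟩ c → γ ⊢⟨ μ ⟩ a → Γ [ γ ⨾ leaf (b ⊖ a) ] ⊢⟨ μ ⟩ c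
  ⊖R₁ : ∀ {μ γ a b} → γ ⨾ leaf a ⊢⟨ μ ⟩ b → γ ⊢⟨ μ ⟩ b ⊖ a
  ⊖R₂ : ∀ {μ γ a b} → leaf a ⨾ γ ⊢⟨ μ ⟩ b → γ ⊢⟨ μ ⟩ b ⊖ a

  𝟎L  : ∀ {μ a} Γ → Γ [ ε ] ⊢⟨ μ ⟩ a → Γ [ leaf 𝟎 ] ⊢⟨ μ ⟩ a
  𝟎R  : ∀ {μ} → ε ⊢⟨ μ ⟩ 𝟎

  -- In this calculus ∧ behaves as a join and ∨ as a meet with respect to ⊢.
  ∧L  : ∀ {μ a b c} Γ →
        Γ [ leaf a ] ⊢⟨ μ ⟩ c → Γ [ leaf b ] ⊢⟨ μ ⟩ c → Γ [ leaf (a ∧ b) ] ⊢⟨ μ ⟩ c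
  ∧R₁ : ∀ {μ γ a b} → γ ⊢⟨ μ ⟩ a → γ ⊢⟨ μ ⟩ a ∧ b
  ∧R₂ : ∀ {μ γ a b} → γ ⊢⟨ μ ⟩ b → γ ⊢⟨ μ ⟩ a ∧ b
  ∨L₁ : ∀ {μ a b c} Γ → Γ [ leaf a ] ⊢⟨ μ ⟩ c → Γ [ leaf (a ∨ b) ] ⊢⟨ μ ⟩ c
  ∨L₂ : ∀ {μ a b c} Γ → Γ [ leaf b ] ⊢⟨ μ ⟩ c → Γ [ leaf (a ∨ b) ] ⊢⟨ μ ⟩ c
  ∨R  : ∀ {μ γ a b} → γ ⊢⟨ μ ⟩ a → γ ⊢⟨ μ ⟩ b → γ ⊢⟨ μ ⟩ a ∨ b

  PL  : ∀ {μ a b} m Γ → Γ [ ⟪ m ⟫ leaf a ] ⊢⟨ μ ⟩ b → Γ [ leaf (P m a) ] ⊢⟨ μ ⟩ b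
  PR  : ∀ {μ γ a} m → γ ⊢⟨ μ ⟩ a → ⟪ m ⟫ γ ⊢⟨ μ ⟩ P m a
  NL  : ∀ {μ a b} m Γ → Γ [ leaf a ] ⊢⟨ μ ⟩ b → Γ [ ⟪ m ⟫ leaf (N m a) ] ⊢⟨ μ ⟩ b
  NR  : ∀ {μ γ a} m → ⟪ m ⟫ γ ⊢⟨ μ ⟩ a → γ ⊢⟨ μ ⟩ N m a

  exch  : ∀ {μ γ δ A} Γ → Γ [ γ ⨾ δ ] ⊢⟨ μ ⟩ A → Γ [ δ ⨾ γ ] ⊢⟨ μ ⟩ A
  assoc : ∀ {μ γ δ π A} Γ → Γ [ γ ⨾ (δ ⨾ π) ] ⊢⟨ μ ⟩ A → Γ [ (γ ⨾ δ) ⨾ π ] ⊢⟨ μ ⟩ A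
  unit⇒ : ∀ {μ γ A} Γ → Γ [ ε ⨾ γ ] ⊢⟨ μ ⟩ A → Γ [ γ ] ⊢⟨ μ ⟩ A
  unit⇐ : ∀ {μ γ A} Γ → Γ [ γ ] ⊢⟨ μ ⟩ A → Γ [ ε ⨾ γ ] ⊢⟨ μ ⟩ A

  ∘₂-intro : ∀ {μ γ A} Γ → Γ [ γ ] ⊢⟨ μ ⟩ A → Γ [ ∘₂ γ ] ⊢⟨ μ ⟩ A
  ∙₂-intro : ∀ {μ γ A} Γ → Γ [ γ ] ⊢⟨ μ ⟩ A → Γ [ ∙₂ γ ] ⊢⟨ μ ⟩ A
  weak     : ∀ {μ γ A} Γ → Γ [ ε ] ⊢⟨ μ ⟩ A → Γ [ γ ] ⊢⟨ μ ⟩ A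

  ∘₂-elim  : ∀ {μ γ δ A} Γ →
             Γ [ ∘₂ γ ] ⊢⟨ μ ⟩ A → Γ [ ∘₂ δ ] ⊢⟨ μ ⟩ A → Γ [ γ ⨾ δ ] ⊢⟨ μ ⟩ A
  ∘₂-dist⇒ : ∀ {μ γ δ A} Γ → Γ [ ∘₂ (γ ⨾ δ) ] ⊢⟨ μ ⟩ A → Γ [ ∘₂ γ ⨾ ∘₂ δ ] ⊢⟨ μ ⟩ A
  ∘₂-dist⇐ : ∀ {μ γ δ A} Γ → Γ [ ∘₂ γ ⨾ ∘₂ δ ] ⊢⟨ μ ⟩ A → Γ [ ∘₂ (γ ⨾ δ) ] ⊢⟨ μ ⟩ A
  ε₁-ax    : ∀ {μ A} → ε₁ ⊢⟨ μ ⟩ A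

  ∙₂∘₂⇒ : ∀ {μ γ δ A} Γ → Γ [ ∙₂ (∘₂ γ ⨾ δ) ] ⊢⟨ μ ⟩ A → Γ [ γ ⨾ ∙₂ δ ] ⊢⟨ μ ⟩ A
  ∙₂∘₂⇐ : ∀ {μ γ δ A} Γ → Γ [ γ ⨾ ∙₂ δ ] ⊢⟨ μ ⟩ A → Γ [ ∙₂ (∘₂ γ ⨾ δ) ] ⊢⟨ μ ⟩ A

  ∘α∘₂-intro : ∀ {μ γ A} Γ → Γ [ γ ] ⊢⟨ μ ⟩ A → Γ [ ∘α ∘₂ γ ] ⊢⟨ μ ⟩ A
  ∘α∙₂-intro : ∀ {μ γ A} Γ → Γ [ γ ] ⊢⟨ μ ⟩ A → Γ [ ∘α ∙₂ γ ] ⊢⟨ μ ⟩ A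
  ∘α-elimʳ   : ∀ {μ γ A} Γ →
               Γ [ ∘α ∘₂ γ ] ⊢⟨ μ ⟩ A → Γ [ ∘α ∙₂ γ ] ⊢⟨ μ ⟩ A → Γ [ γ ] ⊢⟨ μ ⟩ A

  ∘₂∘α-intro : ∀ {μ γ A} Γ → Γ [ γ ] ⊢⟨ μ ⟩ A → Γ [ ∘₂ ∘α γ ] ⊢⟨ μ ⟩ A
  ∙₂∘α-intro : ∀ {μ γ A} Γ → Γ [ γ ] ⊢⟨ μ ⟩ A → Γ [ ∙₂ ∘α γ ] ⊢⟨ μ ⟩ A
  ∘α-elimˡ   : ∀ {μ γ A} Γ →
               Γ [ ∘₂ ∘α γ ] ⊢⟨ μ ⟩ A → Γ [ ∙₂ ∘α γ ] ⊢⟨ μ ⟩ A → Γ [ γ ] ⊢⟨ μ ⟩ A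

  -- d = k / 2ᵐ, unrelated to n
  dyadic-intro : ∀ {μ γ A} Γ k m n → k ≤ 2 ^ m →
                 Γ [ γ ] ⊢⟨ μ ⟩ A →
                 Γ [ ε[ k /2^ m ] ⨾ ∘α^ n (γ ⨾ ε[ 2 ^ m ∸ k /2^ m ]) ] ⊢⟨ μ ⟩ A

  ε-double : ∀ {μ A} Γ n →
             Γ [ ε[ 1 /2^ suc n ] ⨾ ε[ 1 /2^ suc n ] ] ⊢⟨ μ ⟩ A →
             Γ [ ε[ 1 /2^ n ] ] ⊢⟨ μ ⟩ A

  ε-limit : ∀ {μ A} Γ → (∀ n → Γ [ ε[ 1 /2^ n ] ] ⊢⟨ μ ⟩ A) → Γ [ ε ] ⊢⟨ μ ⟩ A

  dyadic-elim : ∀ {μ γ A} Γ n →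
                (∀ k → 1 ≤ k → k ≤ 2 ^ suc n ∸ 2 →
                  Γ [ ε[ 2 ^ suc n ∸ k /2^ suc n ] ⨾ ∘α^ (suc n) (γ ⨾ ε[ k /2^ suc n ]) ] ⊢⟨ μ ⟩ A) →
                Γ [ γ ⨾ ε[ 1 /2^ n ] ] ⊢⟨ μ ⟩ A

{-# OPTIONS --safe #-}

-- Semantic cut elimination with a residuated frame. A set of structures is
-- closed when it is an intersection of sets {γ ∣ Γ[γ] ⊢ c} for cut-free
-- derivability. Interpreting formulas by closed sets validates every rule,
-- including cut: each structural rule mentions every structure variable at most
-- once in each premise and in the conclusion, so it survives substituting
-- arbitrary elements of ⟦ a ⟧ for the leaves a. Since a ∈ ⟦ a ⟧ ⊆ {γ ∣ γ ⊢ a}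
-- by the logical rules alone, truth in this model yields a cut-free derivation.
module Submission where

open import Data.Bool using (true; false; if_then_else_)
open import Data.Nat using (ℕ; zero; suc; _∸_; _^_; _≤_)
open import Data.Nat.Divisibility using (_∣?_; divides)
open import Data.Fin using (Fin)
open import Data.Product using (Σ-syntax; ∃-syntax; _×_; _,_; proj₁; proj₂)
open import Data.Sum using (_⊎_; inj₁; inj₂)
open import Data.Unit using (⊤; tt)
open import Relation.Nullary using (yes; no)
open import Relation.Binary.PropositionalEquality using (_≡_; refl; sym; cong; subst)
open import Defs

-- Contexts and the closure operator.

infix 3 _⊢_

_⊢_ : Structure → Formula → Set
γ ⊢ b = γ ⊢⟨ cutFree ⟩ b

_∘ᶜ_ : Context → Context → Context
hole       ∘ᶜ Δ = Δ
(Γ ⨾ˡ δ)   ∘ᶜ Δ = (Γ ∘ᶜ Δ) ⨾ˡ δ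
(δ ⨾ʳ Γ)   ∘ᶜ Δ = δ ⨾ʳ (Γ ∘ᶜ Δ)
(⟪ m ⟫ᶜ Γ) ∘ᶜ Δ = ⟪ m ⟫ᶜ (Γ ∘ᶜ Δ)

∘ᶜ-[] : ∀ Γ Δ γ → (Γ ∘ᶜ Δ) [ γ ] ≡ Γ [ Δ [ γ ] ]
∘ᶜ-[] hole       Δ γ = refl
∘ᶜ-[] (Γ ⨾ˡ δ)   Δ γ = cong (_⨾ δ) (∘ᶜ-[] Γ Δ γ)
∘ᶜ-[] (δ ⨾ʳ Γ)   Δ γ = cong (δ ⨾_) (∘ᶜ-[] Γ Δ γ)
∘ᶜ-[] (⟪ m ⟫ᶜ Γ) Δ γ = cong (⟪ m ⟫_) (∘ᶜ-[] Γ Δ γ)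

-- The Galois closure for the relation `Γ [ γ ] ⊢ c` between structures `γ` and tests `(Γ, c)`: a
-- member of `Cl X` passes every test that all of `X` passes.
Cl : (Structure → Set) → Structure → Set
Cl X γ = ∀ Γ {c} → (∀ {δ} → X δ → Γ [ δ ] ⊢ c) → Γ [ γ ] ⊢ c

Closed : (Structure → Set) → Set
Closed X = ∀ {γ} → Cl X γ → X γ

Cl-inflationary : ∀ {X γ} → X γ → Cl X γ
Cl-inflationary γ∈ Γ k = k γ∈

-- A test in context `Δ` on `Y` pulls back along `Γ` to a test in `Δ ∘ᶜ Γ` on `X`. This makes the
-- closure compatible with the structural operations.
Cl-lift : ∀ {X Y γ} → Closed Y → ∀ Γ → (∀ {δ} → X δ → Y (Γ [ δ ])) → Cl X γ → Y (Γ [ γ ])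
Cl-lift {γ = γ} Y-closed Γ f γ∈ = Y-closed λ Δ {c} k →
  subst (_⊢ c) (∘ᶜ-[] Δ Γ γ)
    (γ∈ (Δ ∘ᶜ Γ) λ {δ} δ∈ → subst (_⊢ c) (sym (∘ᶜ-[] Δ Γ δ)) (k (f δ∈)))

Cl-closed : ∀ {X} → Closed (Cl X)
Cl-closed γ∈ Γ k = γ∈ Γ λ δ∈ → δ∈ Γ k

-- For `⊖`, `∨` and `N` the sets are residuals, intersections and inverse images, which stay closed;
-- images and unions have to be closed explicitly.
⟦_⟧ : Formula → Structure → Set
⟦ var p ⟧ γ = γ ⊢ var p
⟦ 𝟎 ⟧       = Cl (_≡ ε)
⟦ a ⊕ b ⟧   = Cl λ γ → ∃[ δ ] ∃[ π ] γ ≡ δ ⨾ π × ⟦ a ⟧ δ × ⟦ b ⟧ π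
⟦ b ⊖ a ⟧ γ = ∀ {δ} → ⟦ a ⟧ δ → ⟦ b ⟧ (γ ⨾ δ)
⟦ a ∧ b ⟧   = Cl λ γ → ⟦ a ⟧ γ ⊎ ⟦ b ⟧ γ
⟦ a ∨ b ⟧ γ = ⟦ a ⟧ γ × ⟦ b ⟧ γ
⟦ P m a ⟧   = Cl λ γ → ∃[ δ ] γ ≡ ⟪ m ⟫ δ × ⟦ a ⟧ δ
⟦ N m a ⟧ γ = ⟦ a ⟧ (⟪ m ⟫ γ)

⟦⟧-closed : ∀ a → Closed ⟦ a ⟧
⟦⟧-closed (var p) γ∈     = γ∈ hole λ d → d
⟦⟧-closed 𝟎              = Cl-closed
⟦⟧-closed (a ⊕ b)        = Cl-closed
⟦⟧-closed (b ⊖ a) γ∈ {δ} δ∈ =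
  Cl-lift (⟦⟧-closed b) (hole ⨾ˡ δ) (λ f → f δ∈) γ∈
⟦⟧-closed (a ∧ b)        = Cl-closed
⟦⟧-closed (a ∨ b) γ∈     =
  Cl-lift (⟦⟧-closed a) hole proj₁ γ∈ , Cl-lift (⟦⟧-closed b) hole proj₂ γ∈
⟦⟧-closed (P m a)        = Cl-closed
⟦⟧-closed (N m a)        = Cl-lift (⟦⟧-closed a) (⟪ m ⟫ᶜ hole) (λ δ∈ → δ∈)

mutual
  -- Left rules give the membership, right rules the inclusion `⟦⟧⊆⊢`. The subtrahend of `⊖` is
  -- contravariant, so each half calls the other there.
  leaf∈⟦⟧ : ∀ a → ⟦ a ⟧ (leaf a)
  leaf∈⟦⟧ (var p)     = ax
  leaf∈⟦⟧ 𝟎       Γ k = 𝟎L Γ (k refl)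
  leaf∈⟦⟧ (a ⊕ b) Γ k = ⊕L Γ (k (_ , _ , refl , leaf∈⟦⟧ a , leaf∈⟦⟧ b))
  leaf∈⟦⟧ (b ⊖ a) δ∈  = ⟦⟧-closed b λ Γ k → ⊖L₁ Γ (k (leaf∈⟦⟧ b)) (⟦⟧⊆⊢ a δ∈)
  leaf∈⟦⟧ (a ∧ b) Γ k = ∧L Γ (k (inj₁ (leaf∈⟦⟧ a))) (k (inj₂ (leaf∈⟦⟧ b)))
  leaf∈⟦⟧ (a ∨ b)     = ⟦⟧-closed a (λ Γ k → ∨L₁ Γ (k (leaf∈⟦⟧ a))) ,
                        ⟦⟧-closed b (λ Γ k → ∨L₂ Γ (k (leaf∈⟦⟧ b)))
  leaf∈⟦⟧ (P m a) Γ k = PL m Γ (k (_ , refl , leaf∈⟦⟧ a))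
  leaf∈⟦⟧ (N m a)     = ⟦⟧-closed a λ Γ k → NL m Γ (k (leaf∈⟦⟧ a))

  ⟦⟧⊆⊢ : ∀ a {γ} → ⟦ a ⟧ γ → γ ⊢ a
  ⟦⟧⊆⊢ (var p) γ∈        = γ∈
  ⟦⟧⊆⊢ 𝟎       γ∈        = γ∈ hole λ { refl → 𝟎R }
  ⟦⟧⊆⊢ (a ⊕ b) γ∈        = γ∈ hole λ { (_ , _ , refl , δ∈ , π∈) → ⊕R (⟦⟧⊆⊢ a δ∈) (⟦⟧⊆⊢ b π∈) }
  ⟦⟧⊆⊢ (b ⊖ a) γ∈        = ⊖R₁ (⟦⟧⊆⊢ b (γ∈ (leaf∈⟦⟧ a)))
  ⟦⟧⊆⊢ (a ∧ b) γ∈        = γ∈ hole λ { (inj₁ δ∈) → ∧R₁ (⟦⟧⊆⊢ a δ∈)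
                                     ; (inj₂ δ∈) → ∧R₂ (⟦⟧⊆⊢ b δ∈) }
  ⟦⟧⊆⊢ (a ∨ b) (γ∈ , γ∈′) = ∨R (⟦⟧⊆⊢ a γ∈) (⟦⟧⊆⊢ b γ∈′)
  ⟦⟧⊆⊢ (P m a) γ∈        = γ∈ hole λ { (_ , refl , δ∈) → PR m (⟦⟧⊆⊢ a δ∈) }
  ⟦⟧⊆⊢ (N m a) γ∈        = NR m (⟦⟧⊆⊢ a γ∈)

-- Instances of structures.

infix 4 _∈ˢ_

-- δ ∈ˢ γ: δ arises from γ by replacing each leaf a with some element of ⟦ a ⟧.
data _∈ˢ_ : Structure → Structure → Set where
  leaf  : ∀ {a δ} → ⟦ a ⟧ δ → δ ∈ˢ leaf a
  ε     : ε ∈ˢ ε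
  _⨾_   : ∀ {γ δ γ′ δ′} → γ′ ∈ˢ γ → δ′ ∈ˢ δ → γ′ ⨾ δ′ ∈ˢ γ ⨾ δ
  ⟪_⟫_ : ∀ {γ γ′} m → γ′ ∈ˢ γ → ⟪ m ⟫ γ′ ∈ˢ ⟪ m ⟫ γ

∈ˢ-refl : ∀ γ → γ ∈ˢ γ
∈ˢ-refl (leaf a)    = leaf (leaf∈⟦⟧ a)
∈ˢ-refl ε           = ε
∈ˢ-refl (γ ⨾ δ)     = ∈ˢ-refl γ ⨾ ∈ˢ-refl δ
∈ˢ-refl (⟪ m ⟫ γ)   = ⟪ m ⟫ ∈ˢ-refl γ

-- An instance of `Γ [ γ ]` splits into an instance `Γ′` of the context and one of `γ`. The
-- continuation form avoids transport along an equation, and leaves the hole of `Γ′` free for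
-- another instance.
∈ˢ-plug : ∀ {X : Structure → Set} Γ {γ} →
          (∀ Γ′ → (∀ {x y} → x ∈ˢ y → Γ′ [ x ] ∈ˢ Γ [ y ]) →
            ∀ {γ′} → γ′ ∈ˢ γ → X (Γ′ [ γ′ ])) →
          ∀ {δ} → δ ∈ˢ Γ [ γ ] → X δ
∈ˢ-plug hole       f p           = f hole (λ q → q) p
∈ˢ-plug (Γ ⨾ˡ _)   f (p ⨾ q)     = ∈ˢ-plug Γ (λ Γ′ g → f (Γ′ ⨾ˡ _) λ r → g r ⨾ q) p
∈ˢ-plug (_ ⨾ʳ Γ)   f (p ⨾ q)     = ∈ˢ-plug Γ (λ Γ′ g → f (_ ⨾ʳ Γ′) λ r → p ⨾ g r) q
∈ˢ-plug (⟪ m ⟫ᶜ Γ) f (⟪ .m ⟫ p)  = ∈ˢ-plug Γ (λ Γ′ g → f (⟪ m ⟫ᶜ Γ′) λ r → ⟪ m ⟫ g r) p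

∈ˢ-∘α^ : ∀ n {γ γ′} → γ′ ∈ˢ γ → ∘α^ n γ′ ∈ˢ ∘α^ n γ
∈ˢ-∘α^ zero    p = p
∈ˢ-∘α^ (suc n) p = ⟪ 𝛂 ⟫ ∈ˢ-∘α^ n p

∈ˢ-∘α^⁻¹ : ∀ n {γ δ} → δ ∈ˢ ∘α^ n γ → ∃[ γ′ ] δ ≡ ∘α^ n γ′ × γ′ ∈ˢ γ
∈ˢ-∘α^⁻¹ zero    p = _ , refl , p
∈ˢ-∘α^⁻¹ (suc n) (⟪ .𝛂 ⟫ p) with ∈ˢ-∘α^⁻¹ n p
... | γ′ , refl , q = γ′ , refl , q

data LeafFree : Structure → Set where
  ε     : LeafFree ε
  _⨾_   : ∀ {γ δ} → LeafFree γ → LeafFree δ → LeafFree (γ ⨾ δ)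
  ⟪_⟫_ : ∀ {γ} m → LeafFree γ → LeafFree (⟪ m ⟫ γ)

-- With no leaf to replace, nothing changes. Applied to the dyadic constants, this lets the rules
-- mentioning them survive instantiation.
∈ˢ-leafFree : ∀ {γ δ} → LeafFree γ → δ ∈ˢ γ → δ ≡ γ
∈ˢ-leafFree ε            ε          = refl
∈ˢ-leafFree (f ⨾ g)      (p ⨾ q) with ∈ˢ-leafFree f p | ∈ˢ-leafFree g q
... | refl | refl = refl
∈ˢ-leafFree (⟪ m ⟫ f)    (⟪ .m ⟫ p) = cong (⟪ m ⟫_) (∈ˢ-leafFree f p)

copies-leafFree : ∀ k {γ} → LeafFree γ → LeafFree (copies k γ)
copies-leafFree zero          f = ε
copies-leafFree (suc zero)    f = f
copies-leafFree (suc (suc k)) f = f ⨾ copies-leafFree (suc k) f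

∘α^-leafFree : ∀ n {γ} → LeafFree γ → LeafFree (∘α^ n γ)
∘α^-leafFree zero    f = f
∘α^-leafFree (suc n) f = ⟪ 𝛂 ⟫ ∘α^-leafFree n f

ε[]-leafFree : ∀ k n → LeafFree ε[ k /2^ n ]
ε[]-leafFree k (suc n) with 2 ∣? k
... | yes (divides q _) = ε[]-leafFree q n
... | no  _             = copies-leafFree k (∘α^-leafFree n (⟪ 𝐣 ⟫ ε))
ε[]-leafFree zero    zero = ε
ε[]-leafFree (suc k) zero = ⟪ 𝟐 ⟫ ⟪ 𝐣 ⟫ ε

∈ˢ-ε[] : ∀ k n {δ} → δ ∈ˢ ε[ k /2^ n ] → δ ≡ ε[ k /2^ n ]
∈ˢ-ε[] k n = ∈ˢ-leafFree (ε[]-leafFree k n)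

-- Soundness of the rules, cut included.

record Valid (γ : Structure) (a : Formula) : Set where
  field at : ∀ {δ} → δ ∈ˢ γ → ⟦ a ⟧ δ
open Valid

-- Reduces a rule acting inside a context to a covering condition independent of `Γ` and `A`. An
-- arbitrary index type `I` admits infinitely many premises.
valid-left : ∀ {I : Set} {A γ} Γ (π : I → Structure) →
             (∀ {δ} → δ ∈ˢ γ → Cl (λ x → ∃[ i ] x ∈ˢ π i) δ) →
             (∀ i → Valid (Γ [ π i ]) A) → Valid (Γ [ γ ]) A
valid-left {A = A} Γ π cover v .at = ∈ˢ-plug Γ λ Γ′ g p →
  Cl-lift (⟦⟧-closed A) Γ′ (λ { (i , q) → v i .at (g q) }) (cover p)

valid-left₁ : ∀ {A γ π} Γ →
              (∀ {δ} → δ ∈ˢ γ → Cl (_∈ˢ π) δ) →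
              Valid (Γ [ π ]) A → Valid (Γ [ γ ]) A
valid-left₁ {π = π} Γ cover v =
  valid-left {I = ⊤} Γ (λ _ → π) (λ p Δ k → cover p Δ λ q → k (tt , q)) (λ _ → v)

valid-left₂ : ∀ {A γ π₁ π₂} Γ →
              (∀ {δ} → δ ∈ˢ γ → Cl (λ x → x ∈ˢ π₁ ⊎ x ∈ˢ π₂) δ) →
              Valid (Γ [ π₁ ]) A → Valid (Γ [ π₂ ]) A → Valid (Γ [ γ ]) A
valid-left₂ {π₁ = π₁} {π₂} Γ cover v₁ v₂ =
  valid-left Γ (λ i → if i then π₁ else π₂)
    (λ p Δ k → cover p Δ λ { (inj₁ q) → k (true , q) ; (inj₂ q) → k (false , q) })
    (λ { true → v₁ ; false → v₂ })

-- The axiom ε₁ ⊢ A carries no context, but its validity needs one. It comes for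
-- free: at n = 0 the rule dyadic-elim has no premises.
ε₁-left : ∀ {A} Γ → Γ [ ε₁ ] ⊢ A
ε₁-left Γ = unit⇒ Γ (dyadic-elim Γ 0 λ { zero () _ ; (suc _) _ () })

valid : ∀ {μ γ b} → γ ⊢⟨ μ ⟩ b → Valid γ b
-- Semantically a cut is a substitution: by the first premise, an instance of `γ` may itself replace
-- the leaf `a`.
valid (cut Γ d e) = valid-left₁ Γ (λ p → Cl-inflationary (leaf (valid d .at p))) (valid e)
valid ax .at (leaf δ∈) = δ∈
valid (⊕L Γ d) =
  valid-left₁ Γ (λ { (leaf x∈) Δ k → x∈ Δ λ { (_ , _ , refl , δ∈ , π∈) → k (leaf δ∈ ⨾ leaf π∈) } })
    (valid d)
valid (⊕R d e) .at (p ⨾ q) = Cl-inflationary (_ , _ , refl , valid d .at p , valid e .at q)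
valid (⊖L₁ Γ d e) =
  valid-left₁ Γ (λ { (leaf f ⨾ p) → Cl-inflationary (leaf (f (valid e .at p))) }) (valid d)
valid (⊖L₂ Γ d e) =
  valid-left₁ Γ (λ { (p ⨾ leaf f) Δ k → exch Δ (k (leaf (f (valid e .at p)))) }) (valid d)
valid (⊖R₁ d) .at p δ∈ = valid d .at (p ⨾ leaf δ∈)
-- `⟦ b ⊖ a ⟧` puts the argument on the right, so the comma is exchanged inside the test context.
valid (⊖R₂ {b = b} d) .at p δ∈ = ⟦⟧-closed b λ Δ k → exch Δ (k (valid d .at (leaf δ∈ ⨾ p)))
valid (𝟎L Γ d) =
  valid-left₁ Γ (λ { (leaf x∈) Δ k → x∈ Δ λ { refl → k ε } }) (valid d)
valid 𝟎R .at ε = Cl-inflationary refl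
valid (∧L Γ d e) =
  valid-left₂ Γ (λ { (leaf x∈) Δ k → x∈ Δ λ { (inj₁ δ∈) → k (inj₁ (leaf δ∈))
                                            ; (inj₂ δ∈) → k (inj₂ (leaf δ∈)) } })
    (valid d) (valid e)
valid (∧R₁ d) .at p = Cl-inflationary (inj₁ (valid d .at p))
valid (∧R₂ d) .at p = Cl-inflationary (inj₂ (valid d .at p))
valid (∨L₁ Γ d) = valid-left₁ Γ (λ { (leaf (x∈ , _)) → Cl-inflationary (leaf x∈) }) (valid d)
valid (∨L₂ Γ d) = valid-left₁ Γ (λ { (leaf (_ , x∈)) → Cl-inflationary (leaf x∈) }) (valid d)
valid (∨R d e) .at p = valid d .at p , valid e .at p
valid (PL m Γ d) =
  valid-left₁ Γ (λ { (leaf x∈) Δ k → x∈ Δ λ { (_ , refl , δ∈) → k (⟪ m ⟫ leaf δ∈) } }) (valid d)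
valid (PR m d) .at (⟪ .m ⟫ p) = Cl-inflationary (_ , refl , valid d .at p)
valid (NL m Γ d) = valid-left₁ Γ (λ { (⟪ .m ⟫ leaf x∈) → Cl-inflationary (leaf x∈) }) (valid d)
valid (NR m d) .at p = valid d .at (⟪ m ⟫ p)
valid (exch Γ d) = valid-left₁ Γ (λ { (p ⨾ q) Δ k → exch Δ (k (q ⨾ p)) }) (valid d)
valid (assoc Γ d) = valid-left₁ Γ (λ { ((p ⨾ q) ⨾ r) Δ k → assoc Δ (k (p ⨾ (q ⨾ r))) }) (valid d)
valid (unit⇒ Γ d) = valid-left₁ Γ (λ p Δ k → unit⇒ Δ (k (ε ⨾ p))) (valid d)
valid (unit⇐ Γ d) = valid-left₁ Γ (λ { (ε ⨾ p) Δ k → unit⇐ Δ (k p) }) (valid d)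
valid (∘₂-intro Γ d) = valid-left₁ Γ (λ { (⟪ _ ⟫ p) Δ k → ∘₂-intro Δ (k p) }) (valid d)
valid (∙₂-intro Γ d) = valid-left₁ Γ (λ { (⟪ _ ⟫ p) Δ k → ∙₂-intro Δ (k p) }) (valid d)
valid (weak Γ d) = valid-left₁ Γ (λ _ Δ k → weak Δ (k ε)) (valid d)
valid (∘₂-elim Γ d e) =
  valid-left₂ Γ (λ { (p ⨾ q) Δ k → ∘₂-elim Δ (k (inj₁ (⟪ 𝟐 ⟫ p))) (k (inj₂ (⟪ 𝟐 ⟫ q))) })
    (valid d) (valid e)
valid (∘₂-dist⇒ Γ d) =
  valid-left₁ Γ (λ { ((⟪ _ ⟫ p) ⨾ (⟪ _ ⟫ q)) Δ k → ∘₂-dist⇒ Δ (k (⟪ 𝟐 ⟫ (p ⨾ q))) }) (valid d)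
valid (∘₂-dist⇐ Γ d) =
  valid-left₁ Γ (λ { (⟪ _ ⟫ (p ⨾ q)) Δ k → ∘₂-dist⇐ Δ (k ((⟪ 𝟐 ⟫ p) ⨾ (⟪ 𝟐 ⟫ q))) }) (valid d)
-- `ε₁` passes every test outright, hence lies in every closed set.
valid {b = A} ε₁-ax .at (⟪ _ ⟫ ⟪ _ ⟫ ε) = ⟦⟧-closed A λ Δ _ → ε₁-left Δ
valid (∙₂∘₂⇒ Γ d) =
  valid-left₁ Γ (λ { (p ⨾ (⟪ _ ⟫ q)) Δ k → ∙₂∘₂⇒ Δ (k (⟪ 𝐣 ⟫ ((⟪ 𝟐 ⟫ p) ⨾ q))) }) (valid d)
valid (∙₂∘₂⇐ Γ d) =
  valid-left₁ Γ (λ { (⟪ _ ⟫ ((⟪ _ ⟫ p) ⨾ q)) Δ k → ∙₂∘₂⇐ Δ (k (p ⨾ (⟪ 𝐣 ⟫ q))) }) (valid d)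
valid (∘α∘₂-intro Γ d) =
  valid-left₁ Γ (λ { (⟪ _ ⟫ ⟪ _ ⟫ p) Δ k → ∘α∘₂-intro Δ (k p) }) (valid d)
valid (∘α∙₂-intro Γ d) =
  valid-left₁ Γ (λ { (⟪ _ ⟫ ⟪ _ ⟫ p) Δ k → ∘α∙₂-intro Δ (k p) }) (valid d)
valid (∘α-elimʳ Γ d e) =
  valid-left₂ Γ (λ p Δ k → ∘α-elimʳ Δ (k (inj₁ (⟪ 𝛂 ⟫ ⟪ 𝟐 ⟫ p))) (k (inj₂ (⟪ 𝛂 ⟫ ⟪ 𝐣 ⟫ p))))
    (valid d) (valid e)
valid (∘₂∘α-intro Γ d) =
  valid-left₁ Γ (λ { (⟪ _ ⟫ ⟪ _ ⟫ p) Δ k → ∘₂∘α-intro Δ (k p) }) (valid d)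
valid (∙₂∘α-intro Γ d) =
  valid-left₁ Γ (λ { (⟪ _ ⟫ ⟪ _ ⟫ p) Δ k → ∙₂∘α-intro Δ (k p) }) (valid d)
valid (∘α-elimˡ Γ d e) =
  valid-left₂ Γ (λ p Δ k → ∘α-elimˡ Δ (k (inj₁ (⟪ 𝟐 ⟫ ⟪ 𝛂 ⟫ p))) (k (inj₂ (⟪ 𝐣 ⟫ ⟪ 𝛂 ⟫ p))))
    (valid d) (valid e)
valid (dyadic-intro {γ = γ} Γ k m n k≤ d) = valid-left₁ Γ cover (valid d)
  where
  cover : ∀ {δ} → δ ∈ˢ ε[ k /2^ m ] ⨾ ∘α^ n (γ ⨾ ε[ 2 ^ m ∸ k /2^ m ]) → Cl (_∈ˢ γ) δ
  cover (p ⨾ q) Δ c with ∈ˢ-ε[] k m p | ∈ˢ-∘α^⁻¹ n q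
  -- Both constants are fixed and the `∘α` prefix is peeled off, so only `r`, an instance of `γ`,
  -- remains.
  ... | refl | _ , refl , (r ⨾ s) with ∈ˢ-ε[] (2 ^ m ∸ k) m s
  ... | refl = dyadic-intro Δ k m n k≤ (c r)
valid (ε-double Γ n d) = valid-left₁ Γ cover (valid d)
  where
  cover : ∀ {δ} → δ ∈ˢ ε[ 1 /2^ n ] → Cl (_∈ˢ ε[ 1 /2^ suc n ] ⨾ ε[ 1 /2^ suc n ]) δ
  cover p Δ k with ∈ˢ-ε[] 1 n p
  ... | refl = ε-double Δ n (k (∈ˢ-refl _))
valid (ε-limit Γ d) =
  valid-left Γ (λ n → ε[ 1 /2^ n ]) (λ { ε Δ k → ε-limit Δ λ n → k (n , ∈ˢ-refl _) })
    (λ n → valid (d n))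
valid (dyadic-elim {γ = γ} Γ n d) = valid-left Γ π cover λ (k , 1≤k , k≤) → valid (d k 1≤k k≤)
  where
  -- The bounds sit in the index because a premise is available only for `k` within them.
  I = Σ[ k ∈ ℕ ] 1 ≤ k × k ≤ 2 ^ suc n ∸ 2

  π : I → Structure
  π (k , _) = ε[ 2 ^ suc n ∸ k /2^ suc n ] ⨾ ∘α^ (suc n) (γ ⨾ ε[ k /2^ suc n ])

  cover : ∀ {δ} → δ ∈ˢ γ ⨾ ε[ 1 /2^ n ] → Cl (λ x → ∃[ i ] x ∈ˢ π i) δ
  cover (p ⨾ q) Δ c with ∈ˢ-ε[] 1 n q
  ... | refl = dyadic-elim Δ n λ k 1≤k k≤ →
    c ((k , 1≤k , k≤) , ∈ˢ-refl _ ⨾ ∈ˢ-∘α^ (suc n) (p ⨾ ∈ˢ-refl _))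

cut-elimination : ∀ {γ b} → γ ⊢⟨ withCut ⟩ b → γ ⊢⟨ cutFree ⟩ b
cut-elimination {γ} {b} d = ⟦⟧⊆⊢ b (valid d .at (∈ˢ-refl γ))

theorem4p1p4 : ∀ (n : ℕ) (a : Fin n → Formula) (b : Formula) (G : Term (Fin n)) →
    G ⟨ (λ i → leaf (a i)) ⟩ ⊢⟨ withCut ⟩ b →
    G ⟨ (λ i → leaf (a i)) ⟩ ⊢⟨ cutFree ⟩ b
theorem4p1p4 _ _ _ _ = cut-elimination
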